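{- Let $G$ be a finite simple graph and let $v_1,\dots,v_r$, $r\ge 2$, be an $\alpha$-sequence in $G$ such that $N(v_1,\dots,v_{r-1})$ is a $\delta$-set in $G$. Then (a) $\varphi(G)\le r\le \omega(G)$; and (b) $r\ge W(G)$.
   Context: Graphs are finite, undirected, without loops or multiple edges; $n=|V(G)|$, $N(v)$ is the set of vertices adjacent to $v$, $d(v)=|N(v)|$, and for $V\subseteq V(G)$, $N(V)=\bigcap_{v\in V}N(v)$; $N(v_1,\dots,v_k)$ means $N(\{v_1,\dots,v_k\})$. $\omega(G)$ is the clique number of $G$ (largest $p$ such that $G$ has $p$ pairwise adjacent vertices). For $V\subseteq V(G)$ define $W(V)=\sum_{v\in V}\frac{1}{n-d(v)}$ and $W(G)=W(V(G))$. A set $V\subseteq V(G)$ is a $\delta$-set in $G$ if $d(v)\le n-|V|$ for all $v\in V$. $G$ is a generalized $r$-partite graph if $V(G)=V_1\cup\dots\cup V_r$ with $V_i\cap V_j=\emptyset$ for $i\ne j$ and each $V_i$ a $\delta$-set in $G$; $\varphi(G)$ is the smallest such $r$. A sequence $v_1,\dots,v_r$ of vertices is an $\alpha$-sequence in $G$ if (i) $d(v_1)=\max\{d(v)\mid v\in V(G)\}$, and (ii) for $2\le i\le r$, $v_i\in N(v_1,\dots,v_{i-1})$ and $v_i$ has maximal degree in the induced subgraph $G[N(v_1,\dots,v_{i-1})]$. -}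

module Defs where

open import Data.Nat using (ℕ; zero; suc; _≤_; _<_; _∸_; z≤n; s≤s; >-nonZero)
import Data.Nat.Properties as ℕ
open import Data.Integer using (+_)
open import Data.Rational as ℚ using (ℚ; 0ℚ)
open import Data.Fin using (Fin; toℕ)
import Data.Fin.Properties as Fin
open import Data.Fin.Subset using (Subset; _∈_; _∉_; _∩_; ⋂; ∣_∣; ⁅_⁆; ⊤; ⊥; Empty)
open import Data.Fin.Subset.Properties
open import Data.List as List using (List; allFin; filter)
open import Data.Vec as Vec using (Vec; []; _∷_; lookup; toList)
open import Data.Vec.Properties using (lookup∘tabulate; []=⇒lookup)
open import Data.Product using (∃; _×_; _,_; proj₁)
open import Function using (_∘_)
open import Level using (Level; 0ℓ)
open import Relation.Binary using (Rel; Irreflexive; Symmetric)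
import Relation.Binary as B
open import Relation.Binary.PropositionalEquality
  using (_≡_; _≢_; refl; sym; trans; subst)
open import Relation.Nullary using (Dec; yes; no; does; contradiction)
open import Relation.Nullary.Decidable using (_×-dec_; _→-dec_; ¬?; map′)
open import Relation.Unary using (Pred; Decidable)

private variable
  ℓ : Level
  n r k : ℕ

IsLeast : Pred ℕ ℓ → Pred ℕ ℓ
IsLeast P k = P k × (∀ j → P j → k ≤ j)

IsGreatest : Pred ℕ ℓ → Pred ℕ ℓ
IsGreatest P k = P k × (∀ j → P j → j ≤ k)

least : {P : Pred ℕ ℓ} → Decidable P → P k → ∃ (IsLeast P)
least {k = zero} P? p = zero , p , λ _ _ → z≤n
least {k = suc k} {P = P} P? p with P? 0
... | yes p₀ = zero , p₀ , λ _ _ → z≤n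
... | no ¬p₀ with least {k = k} (P? ∘ suc) p
...   | m , pm , min = suc m , pm , λ where
          zero    p₀ → contradiction p₀ ¬p₀
          (suc j) pj → s≤s (min j pj)

greatest : {P : Pred ℕ ℓ} → Decidable P → P 0 → ∀ b → (∀ j → P j → j ≤ b) →
           ∃ (IsGreatest P)
greatest P? p₀ zero    bound = 0 , p₀ , bound
greatest P? p₀ (suc b) bound with P? (suc b)
... | yes p = suc b , p , bound
... | no ¬p = greatest P? p₀ b λ j pj → ℕ.≤-pred
        (ℕ.≤∧≢⇒< (bound j pj) λ { refl → ¬p pj })

-- A finite simple graph with vertex set Fin n.
record Graph (n : ℕ) : Set₁ where
  field
    _~_    : Rel (Fin n) 0ℓ
    _~?_   : B.Decidable _~_
    ~-sym  : Symmetric _~_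
    ~-irr  : Irreflexive _≡_ _~_

module _ (G : Graph n) where
  open Graph G

  neighbours : Fin n → Subset n
  neighbours v = Vec.tabulate λ w → does (v ~? w)

  -- For the empty list this is the whole vertex set.
  commonNeighbours : List (Fin n) → Subset n
  commonNeighbours vs = ⋂ (List.map neighbours vs)

  degree : Fin n → ℕ
  degree v = ∣ neighbours v ∣

  -- For v ∈ S, the degree of v in the induced subgraph G[S].
  inducedDegree : Subset n → Fin n → ℕ
  inducedDegree S v = ∣ neighbours v ∩ S ∣

  v∉neighbours : ∀ v → v ∉ neighbours v
  v∉neighbours v v∈ with v ~? v | trans (sym (lookup∘tabulate (λ w → does (v ~? w)) v)) ([]=⇒lookup v∈)
  ... | yes v~v | _ = ~-irr refl v~v
  ... | no _    | ()

  degree<n : ∀ v → degree v < n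
  degree<n v = subst (degree v <_) (∣⊤∣≡n n)
    (p⊂q⇒∣p∣<∣q∣ (⊆⊤ , v , ∈⊤ , v∉neighbours v))

  -- The subtraction is exact, by degree<n.
  vertexWeight : Fin n → ℚ
  vertexWeight v = (+ 1) ℚ./ (n ∸ degree v)
    where instance _ = >-nonZero (ℕ.m<n⇒0<n∸m (degree<n v))

  W : Subset n → ℚ
  W V = List.foldr ℚ._+_ 0ℚ (List.map vertexWeight (filter (_∈? V) (allFin n)))

  IsDeltaSet : Subset n → Set
  IsDeltaSet V = ∀ v → v ∈ V → degree v ≤ n ∸ ∣ V ∣

  -- Parts may be empty, and are indexed by Fin r.
  record IsDeltaPartition (parts : Vec (Subset n) r) : Set where
    constructor mkPartition
    field
      covers   : ∀ v → ∃ λ i → v ∈ lookup parts i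
      disjoint : ∀ i j → i ≢ j → Empty (lookup parts i ∩ lookup parts j)
      deltaSet : ∀ i → IsDeltaSet (lookup parts i)

  GeneralizedPartite : ℕ → Set
  GeneralizedPartite r = ∃ λ (parts : Vec (Subset n) r) → IsDeltaPartition parts

  IsClique : Subset n → Set
  IsClique V = ∀ u → u ∈ V → ∀ v → v ∈ V → u ≢ v → u ~ v

  HasClique : ℕ → Set
  HasClique p = ∃ λ (V : Subset n) → ∣ V ∣ ≡ p × IsClique V

  -- Positions are 0-based: the entries before position i are v₁,…,vᵢ in
  -- 1-based notation, so `before vs i` is N(v₁,…,vᵢ).
  before : Vec (Fin n) r → ℕ → Subset n
  before vs i = commonNeighbours (List.take i (toList vs))

  record IsAlphaSequence (vs : Vec (Fin n) r) : Set where
    field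
      first  : ∀ i → toℕ i ≡ 0 → ∀ u → degree u ≤ degree (lookup vs i)
      member : ∀ i → 1 ≤ toℕ i → lookup vs i ∈ before vs (toℕ i)
      maxdeg : ∀ i → 1 ≤ toℕ i → ∀ u → u ∈ before vs (toℕ i) →
               inducedDegree (before vs (toℕ i)) u
                 ≤ inducedDegree (before vs (toℕ i)) (lookup vs i)

  isDeltaSet? : Decidable IsDeltaSet
  isDeltaSet? V = Fin.all? λ v → (v ∈? V) →-dec (degree v ℕ.≤? n ∸ ∣ V ∣)

  isDeltaPartition? : Decidable (IsDeltaPartition {r})
  isDeltaPartition? parts = map′
    (λ (c , d , δ) → mkPartition c d δ)
    (λ (mkPartition c d δ) → c , d , δ)
    ( Fin.all? (λ v → Fin.any? λ i → v ∈? lookup parts i)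
    ×-dec Fin.all? (λ i → Fin.all? λ j → ¬? (i Fin.≟ j) →-dec
            ¬? (nonempty? (lookup parts i ∩ lookup parts j)))
    ×-dec Fin.all? (λ i → isDeltaSet? (lookup parts i)))

  isClique? : Decidable IsClique
  isClique? V = Fin.all? λ u → (u ∈? V) →-dec Fin.all? λ v → (v ∈? V) →-dec
    (¬? (u Fin.≟ v) →-dec (u ~? v))

  hasClique? : Decidable HasClique
  hasClique? p = anySubset? λ V → (∣ V ∣ ℕ.≟ p) ×-dec isClique? V

anySubsets? : {P : Pred (Vec (Subset n) r) ℓ} → Decidable P → Dec (∃ P)
anySubsets? {r = zero}  P? = map′ (_ ,_) (λ { ([] , p) → p }) (P? [])
anySubsets? {r = suc r} P? = map′
  (λ (V , Vs , p) → V ∷ Vs , p)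
  (λ { (V ∷ Vs , p) → V , Vs , p })
  (anySubset? λ V → anySubsets? λ Vs → P? (V ∷ Vs))

module _ (G : Graph n) where

  generalizedPartite? : Decidable (GeneralizedPartite G)
  generalizedPartite? r = anySubsets? (isDeltaPartition? G)

  singletons : GeneralizedPartite G n
  singletons = Vec.tabulate ⁅_⁆ , mkPartition
    (λ v → v , subst (v ∈_) (sym (lookup∘tabulate ⁅_⁆ v)) (x∈⁅x⁆ v))
    disjoint
    λ i → subst (IsDeltaSet G) (sym (lookup∘tabulate ⁅_⁆ i)) λ v _ →
      subst (λ m → degree G v ≤ n ∸ m) (sym (∣⁅x⁆∣≡1 i)) (ℕ.∸-monoˡ-≤ 1 (degree<n G v))
    where
    disjoint : ∀ i j → i ≢ j →
      Empty (lookup (Vec.tabulate ⁅_⁆) i ∩ lookup (Vec.tabulate ⁅_⁆) j)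
    disjoint i j i≢j (x , x∈)
      rewrite lookup∘tabulate {n = n} ⁅_⁆ i | lookup∘tabulate {n = n} ⁅_⁆ j
      with x∈p∩q⁻ ⁅ i ⁆ ⁅ j ⁆ x∈
    ... | x∈i , x∈j = i≢j (trans (sym (x∈⁅y⁆⇒x≡y i x∈i)) (x∈⁅y⁆⇒x≡y j x∈j))

  φ-exists : ∃ (IsLeast (GeneralizedPartite G))
  φ-exists = least generalizedPartite? singletons

  φ : ℕ
  φ = φ-exists .proj₁

  ω-exists : ∃ (IsGreatest (HasClique G))
  ω-exists = greatest (hasClique? G)
    (⊥ , ∣⊥∣≡0 n , λ u u∈ → contradiction u∈ ∉⊥)
    n (λ { _ (V , refl , _) → ∣p∣≤n V })

  ω : ℕ
  ω = ω-exists .proj₁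

{-# OPTIONS --safe #-}

-- A maximal-degree vertex v of G[S] splits S into S ─ N(v) and S ∩ N(v). For u ∈ S,
-- d(u) ≤ |N(v) ∩ S| + (n − |S|) = n − |S ─ N(v)|, so the first piece is a δ-set. Along an
-- α-sequence this cuts V(G) into r δ-sets, the last one being N(v₁,…,vᵣ₋₁), while the chosen
-- vertices form a clique. A δ-set V has weight at most 1, because each of its |V| vertices
-- has n − d(v) ≥ |V|.
module Submission where

open import Defs
open import Data.Nat using (ℕ; zero; suc; _+_; _≤_; _<_; _∸_; z≤n; s≤s; NonZero; >-nonZero)
import Data.Nat.Properties as ℕ
open import Data.Integer as ℤ using (+_)
import Data.Integer.Properties as ℤ
open import Data.Rational as ℚ using (ℚ; mkℚ; 0ℚ; 1ℚ)
import Data.Rational.Properties as ℚ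
import Data.Rational.Unnormalised as ℚᵘ
import Data.Rational.Unnormalised.Properties as ℚᵘ
open import Data.Fin using (Fin; zero; suc; toℕ; fromℕ; fromℕ<)
import Data.Fin.Properties as Fin
open import Data.Fin.Subset
  using (Subset; inside; outside; _∈_; _∉_; _⊆_; _∩_; _∪_; _─_; ∣_∣; ⁅_⁆; ⊤; Empty)
open import Data.Fin.Subset.Properties
open import Data.List as List using (filter; tabulate)
import Data.Nat.Coprimality as Coprime
open import Data.Product using (∃; _×_; _,_; proj₁; proj₂)
open import Data.Sum using (inj₁; inj₂)
open import Data.Vec using (Vec; []; _∷_; lookup; here; there)
open import Data.Vec.Properties using (lookup∘tabulate; []=⇒lookup)
open import Function using (id; _∘_)
open import Level using (0ℓ)
open import Relation.Binary.PropositionalEquality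
  using (_≡_; _≢_; refl; sym; trans; cong; cong₂; subst; module ≡-Reasoning)
open import Relation.Nullary using (does; yes; no; contradiction)
open import Relation.Unary using (Pred; Decidable)

private variable
  n r : ℕ

-- Cardinalities of finite subsets.

x∈p─q⇒x∉q : ∀ (p q : Subset n) {x} → x ∈ p ─ q → x ∉ q
x∈p─q⇒x∉q (_ ∷ p) (outside ∷ q) (there x∈) (there x∈q) = x∈p─q⇒x∉q p q x∈ x∈q
x∈p─q⇒x∉q (_ ∷ p) (inside ∷ q)  (there x∈) (there x∈q) = x∈p─q⇒x∉q p q x∈ x∈q

∣p─q∣+∣p∩q∣≡∣p∣ : ∀ (p q : Subset n) → ∣ p ─ q ∣ + ∣ p ∩ q ∣ ≡ ∣ p ∣
∣p─q∣+∣p∩q∣≡∣p∣ []            []            = refl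
∣p─q∣+∣p∩q∣≡∣p∣ (inside  ∷ p) (inside  ∷ q) =
  trans (ℕ.+-suc ∣ p ─ q ∣ ∣ p ∩ q ∣) (cong suc (∣p─q∣+∣p∩q∣≡∣p∣ p q))
∣p─q∣+∣p∩q∣≡∣p∣ (inside  ∷ p) (outside ∷ q) = cong suc (∣p─q∣+∣p∩q∣≡∣p∣ p q)
∣p─q∣+∣p∩q∣≡∣p∣ (outside ∷ p) (inside  ∷ q) = ∣p─q∣+∣p∩q∣≡∣p∣ p q
∣p─q∣+∣p∩q∣≡∣p∣ (outside ∷ p) (outside ∷ q) = ∣p─q∣+∣p∩q∣≡∣p∣ p q

∣p─q∣+∣q∣≤n : ∀ (p q : Subset n) → ∣ p ─ q ∣ + ∣ q ∣ ≤ n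
∣p─q∣+∣q∣≤n []            []            = z≤n
∣p─q∣+∣q∣≤n (x       ∷ p) (inside  ∷ q) =
  ℕ.≤-trans (ℕ.≤-reflexive (ℕ.+-suc ∣ p ─ q ∣ ∣ q ∣)) (s≤s (∣p─q∣+∣q∣≤n p q))
∣p─q∣+∣q∣≤n (inside  ∷ p) (outside ∷ q) = s≤s (∣p─q∣+∣q∣≤n p q)
∣p─q∣+∣q∣≤n (outside ∷ p) (outside ∷ q) = ℕ.m≤n⇒m≤1+n (∣p─q∣+∣q∣≤n p q)

x∉p⇒∣⁅x⁆∪p∣≡1+∣p∣ : ∀ {x} (p : Subset n) → x ∉ p → ∣ ⁅ x ⁆ ∪ p ∣ ≡ suc ∣ p ∣
x∉p⇒∣⁅x⁆∪p∣≡1+∣p∣ {x = zero}  (inside  ∷ p) x∉p = contradiction here x∉p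
x∉p⇒∣⁅x⁆∪p∣≡1+∣p∣ {x = zero}  (outside ∷ p) x∉p = cong (suc ∘ ∣_∣) (∪-identityˡ p)
x∉p⇒∣⁅x⁆∪p∣≡1+∣p∣ {x = suc x} (inside  ∷ p) x∉p = cong suc (x∉p⇒∣⁅x⁆∪p∣≡1+∣p∣ p (x∉p ∘ there))
x∉p⇒∣⁅x⁆∪p∣≡1+∣p∣ {x = suc x} (outside ∷ p) x∉p = x∉p⇒∣⁅x⁆∪p∣≡1+∣p∣ p (x∉p ∘ there)

-- Arithmetic of rational numbers.

ι : ℕ → ℚ
ι k = (+ k) ℚ./ 1

ι-suc : ∀ k → ι (suc k) ≡ 1ℚ ℚ.+ ι k
ι-suc k = begin
  (+ suc k) ℚ./ 1  ≡⟨ cong (λ i → (+ 1 ℤ.+ i) ℚ./ 1) (ℤ.*-identityʳ (+ k)) ⟨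
  -- The fraction k/1 is written out in lowest terms so that the addition computes; `ι k` itself
  -- still has a gcd to divide out.
  1ℚ ℚ.+ mkℚ (+ k) 0 (Coprime.sym (Coprime.1-coprimeTo k))
    ≡⟨ cong (1ℚ ℚ.+_) (ℚ.↥p/↧p≡p (mkℚ (+ k) 0 (Coprime.sym (Coprime.1-coprimeTo k)))) ⟨
  1ℚ ℚ.+ ι k ∎
  where open ≡-Reasoning

-- Unnormalised rationals carry no gcd, so there this is the plain inverse law; the next lemma takes
-- the same detour.
ι-*-inverse : ∀ k → ι (suc k) ℚ.* ((+ 1) ℚ./ suc k) ≡ 1ℚ
ι-*-inverse k = ℚ.toℚᵘ-injective (begin
  ℚ.toℚᵘ (ι (suc k) ℚ.* ((+ 1) ℚ./ suc k))
    ≈⟨ ℚ.toℚᵘ-homo-* (ι (suc k)) ((+ 1) ℚ./ suc k) ⟩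
  ℚ.toℚᵘ (ι (suc k)) ℚᵘ.* ℚ.toℚᵘ ((+ 1) ℚ./ suc k)
    ≈⟨ ℚᵘ.*-cong (ℚ.toℚᵘ-fromℚᵘ (ℚᵘ.mkℚᵘ (+ suc k) 0)) (ℚ.toℚᵘ-fromℚᵘ (ℚᵘ.mkℚᵘ (+ 1) k)) ⟩
  ℚᵘ.mkℚᵘ (+ suc k) 0 ℚᵘ.* ℚᵘ.mkℚᵘ (+ 1) k
    ≈⟨ ℚᵘ.*-inverseʳ (ℚᵘ.mkℚᵘ (+ suc k) 0) ⟩
  ℚᵘ.1ℚᵘ ∎)
  where open import Relation.Binary.Reasoning.Setoid ℚᵘ.≃-setoid

1/-antimono-≤ : ∀ {j k} .{{_ : NonZero j}} .{{_ : NonZero k}} →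
                j ≤ k → (+ 1) ℚ./ k ℚ.≤ (+ 1) ℚ./ j
1/-antimono-≤ {suc j} {suc k} j≤k = ℚ.toℚᵘ-cancel-≤ (begin
  ℚ.toℚᵘ ((+ 1) ℚ./ suc k)  ≃⟨ ℚ.toℚᵘ-fromℚᵘ (ℚᵘ.mkℚᵘ (+ 1) k) ⟩
  ℚᵘ.mkℚᵘ (+ 1) k           ≤⟨ ℚᵘ.*≤* (ℤ.*-monoˡ-≤-nonNeg (+ 1) (ℤ.+≤+ j≤k)) ⟩
  ℚᵘ.mkℚᵘ (+ 1) j           ≃⟨ ℚ.toℚᵘ-fromℚᵘ (ℚᵘ.mkℚᵘ (+ 1) j) ⟨
  ℚ.toℚᵘ ((+ 1) ℚ./ suc j)  ∎)
  where open ℚᵘ.≤-Reasoning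

-- Sums over subsets.

sumOver : (Fin n → ℚ) → Subset n → ℚ
sumOver f []            = 0ℚ
sumOver f (inside  ∷ p) = f zero ℚ.+ sumOver (f ∘ suc) p
sumOver f (outside ∷ p) = sumOver (f ∘ suc) p

-- Turns the filtered list in `W` into a recursion on the characteristic vector, on which splitting
-- and bounding are direct inductions. `g` is arbitrary because the tail of `tabulate g` is
-- `tabulate (g ∘ suc)`.
sum-filter-tabulate : ∀ {A : Set} {P : Pred A 0ℓ} (P? : Decidable P) (f : A → ℚ)
  (g : Fin n → A) (p : Subset n) → (∀ {i} → i ∈ p → P (g i)) → (∀ {i} → P (g i) → i ∈ p) →
  List.foldr ℚ._+_ 0ℚ (List.map f (filter P? (tabulate g))) ≡ sumOver (f ∘ g) p
sum-filter-tabulate P? f g [] to from = refl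
sum-filter-tabulate P? f g (s ∷ p) to from
  with ih ← sum-filter-tabulate P? f (g ∘ suc) p (to ∘ there) (drop-there ∘ from)
  with P? (g zero) | s
... | yes _   | inside  = cong (f (g zero) ℚ.+_) ih
... | yes Pg₀ | outside = contradiction (from Pg₀) λ ()
... | no ¬Pg₀ | inside  = contradiction (to here) ¬Pg₀
... | no _    | outside = ih

sumOver-split : ∀ (f : Fin n → ℚ) p q → sumOver f p ≡ sumOver f (p ─ q) ℚ.+ sumOver f (p ∩ q)
sumOver-split f []            []            = refl
sumOver-split f (inside  ∷ p) (inside  ∷ q) = begin
  f zero ℚ.+ sumOver f′ p                                    ≡⟨ cong (f zero ℚ.+_) (sumOver-split f′ p q) ⟩
  f zero ℚ.+ (sumOver f′ (p ─ q) ℚ.+ sumOver f′ (p ∩ q))     ≡⟨ ℚ.+-assoc (f zero) _ _ ⟨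
  (f zero ℚ.+ sumOver f′ (p ─ q)) ℚ.+ sumOver f′ (p ∩ q)     ≡⟨ cong (ℚ._+ sumOver f′ (p ∩ q)) (ℚ.+-comm (f zero) _) ⟩
  (sumOver f′ (p ─ q) ℚ.+ f zero) ℚ.+ sumOver f′ (p ∩ q)     ≡⟨ ℚ.+-assoc (sumOver f′ (p ─ q)) (f zero) (sumOver f′ (p ∩ q)) ⟩
  sumOver f′ (p ─ q) ℚ.+ (f zero ℚ.+ sumOver f′ (p ∩ q))     ∎
  where
  open ≡-Reasoning
  f′ = f ∘ suc
sumOver-split f (inside  ∷ p) (outside ∷ q) =
  trans (cong (f zero ℚ.+_) (sumOver-split (f ∘ suc) p q)) (sym (ℚ.+-assoc (f zero) _ _))
sumOver-split f (outside ∷ p) (inside  ∷ q) = sumOver-split (f ∘ suc) p q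
sumOver-split f (outside ∷ p) (outside ∷ q) = sumOver-split (f ∘ suc) p q

sumOver-≤ : ∀ {f : Fin n → ℚ} {c} p → (∀ {i} → i ∈ p → f i ℚ.≤ c) →
            sumOver f p ℚ.≤ ι ∣ p ∣ ℚ.* c
sumOver-≤ {c = c} [] f≤c = ℚ.≤-reflexive (sym (ℚ.*-zeroˡ c))
sumOver-≤ {f = f} {c} (inside ∷ p) f≤c = begin
  f zero ℚ.+ sumOver (f ∘ suc) p  ≤⟨ ℚ.+-mono-≤ (f≤c here) (sumOver-≤ p (f≤c ∘ there)) ⟩
  c ℚ.+ ι ∣ p ∣ ℚ.* c             ≡⟨ cong (ℚ._+ ι ∣ p ∣ ℚ.* c) (ℚ.*-identityˡ c) ⟨
  1ℚ ℚ.* c ℚ.+ ι ∣ p ∣ ℚ.* c      ≡⟨ ℚ.*-distribʳ-+ c 1ℚ (ι ∣ p ∣) ⟨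
  (1ℚ ℚ.+ ι ∣ p ∣) ℚ.* c          ≡⟨ cong (ℚ._* c) (ι-suc ∣ p ∣) ⟨
  ι (suc ∣ p ∣) ℚ.* c             ∎
  where open ℚ.≤-Reasoning
sumOver-≤ (outside ∷ p) f≤c = sumOver-≤ p (f≤c ∘ there)

-- Weights and δ-sets in a graph.

module _ (G : Graph n) where
  open Graph G

  ∈neighbours⇒~ : ∀ {u v} → u ∈ neighbours G v → v ~ u
  ∈neighbours⇒~ {u} {v} u∈
    with v ~? u | trans (sym (lookup∘tabulate (λ w → does (v ~? w)) u)) ([]=⇒lookup u∈)
  ... | yes v~u | _ = v~u
  ... | no _    | ()

  W≡sumOver : ∀ V → W G V ≡ sumOver (vertexWeight G) V
  W≡sumOver V = sum-filter-tabulate (_∈? V) (vertexWeight G) id V id id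

  W-split : ∀ S T → W G S ≡ W G (S ─ T) ℚ.+ W G (S ∩ T)
  W-split S T = trans (W≡sumOver S) (trans (sumOver-split (vertexWeight G) S T)
    (sym (cong₂ ℚ._+_ (W≡sumOver (S ─ T)) (W≡sumOver (S ∩ T)))))

  deltaSet-weight≤1 : ∀ {V} → IsDeltaSet G V → W G V ℚ.≤ 1ℚ
  deltaSet-weight≤1 {V} δ = subst (ℚ._≤ 1ℚ) (sym (W≡sumOver V)) (bound ∣ V ∣ refl)
    where
    weight≤ : ∀ {k v} .{{_ : NonZero k}} → k ≤ n ∸ degree G v → vertexWeight G v ℚ.≤ (+ 1) ℚ./ k
    weight≤ {v = v} k≤ = 1/-antimono-≤ k≤
      where instance _ = >-nonZero (ℕ.m<n⇒0<n∸m (degree<n G v))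

    -- The bound 1/∣V∣ on each weight exists only for nonempty `V`, hence the case split on the
    -- size.
    bound : ∀ k → ∣ V ∣ ≡ k → sumOver (vertexWeight G) V ℚ.≤ 1ℚ
    bound zero eq = begin
      -- Any common bound would do, as it is multiplied by `ι 0`; 1 is available since n - d(v) ≥ 1.
      sumOver (vertexWeight G) V  ≤⟨ sumOver-≤ V (λ {v} _ → weight≤ (ℕ.m<n⇒0<n∸m (degree<n G v))) ⟩
      ι ∣ V ∣ ℚ.* 1ℚ              ≡⟨ cong (λ k → ι k ℚ.* 1ℚ) eq ⟩
      0ℚ                          ≤⟨ ℚ.nonNegative⁻¹ 1ℚ ⟩
      1ℚ                          ∎
      where open ℚ.≤-Reasoning
    bound (suc k) eq = begin
      sumOver (vertexWeight G) V
        ≤⟨ sumOver-≤ V (λ {v} v∈V → weight≤ (subst (_≤ n ∸ degree G v) eq (∣V∣≤ v v∈V))) ⟩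
      ι ∣ V ∣ ℚ.* ((+ 1) ℚ./ suc k)    ≡⟨ cong (λ k′ → ι k′ ℚ.* ((+ 1) ℚ./ suc k)) eq ⟩
      ι (suc k) ℚ.* ((+ 1) ℚ./ suc k)  ≡⟨ ι-*-inverse k ⟩
      1ℚ                               ∎
      where
      open ℚ.≤-Reasoning
      ∣V∣≤ : ∀ v → v ∈ V → ∣ V ∣ ≤ n ∸ degree G v
      -- n - d(v) ≥ n - (n - ∣V∣), which equals ∣V∣ because ∣V∣ ≤ n makes the truncated subtraction
      -- exact.
      ∣V∣≤ v v∈V = subst (_≤ n ∸ degree G v) (ℕ.m∸[m∸n]≡n (∣p∣≤n V)) (ℕ.∸-monoʳ-≤ n (δ v v∈V))

  nonneighbours-deltaSet : ∀ {S v} →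
    (∀ u → u ∈ S → inducedDegree G S u ≤ inducedDegree G S v) → IsDeltaSet G (S ─ neighbours G v)
  nonneighbours-deltaSet {S} {v} max u u∈ = ℕ.m+n≤o⇒m≤o∸n (degree G u) (begin
    ∣ Nu ∣ + ∣ S ─ Nv ∣                      ≡⟨ cong (_+ ∣ S ─ Nv ∣) (∣p─q∣+∣p∩q∣≡∣p∣ Nu S) ⟨
    (∣ Nu ─ S ∣ + ∣ Nu ∩ S ∣) + ∣ S ─ Nv ∣   ≡⟨ ℕ.+-assoc ∣ Nu ─ S ∣ _ _ ⟩
    -- Maximality trades the neighbours of `u` in `S` for those of `v`, which together with `S ─ Nv`
    -- make up exactly `S`.
    ∣ Nu ─ S ∣ + (∣ Nu ∩ S ∣ + ∣ S ─ Nv ∣)   ≤⟨ ℕ.+-monoʳ-≤ ∣ Nu ─ S ∣ (ℕ.+-monoˡ-≤ _ (max u (p─q⊆p S Nv u∈))) ⟩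
    ∣ Nu ─ S ∣ + (∣ Nv ∩ S ∣ + ∣ S ─ Nv ∣)   ≡⟨ cong (_+_ ∣ Nu ─ S ∣) (ℕ.+-comm ∣ Nv ∩ S ∣ _) ⟩
    ∣ Nu ─ S ∣ + (∣ S ─ Nv ∣ + ∣ Nv ∩ S ∣)   ≡⟨ cong (λ p → ∣ Nu ─ S ∣ + (∣ S ─ Nv ∣ + ∣ p ∣)) (∩-comm Nv S) ⟩
    ∣ Nu ─ S ∣ + (∣ S ─ Nv ∣ + ∣ S ∩ Nv ∣)   ≡⟨ cong (_+_ ∣ Nu ─ S ∣) (∣p─q∣+∣p∩q∣≡∣p∣ S Nv) ⟩
    ∣ Nu ─ S ∣ + ∣ S ∣                       ≤⟨ ∣p─q∣+∣q∣≤n Nu S ⟩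
    n                                        ∎)
    where
    open ℕ.≤-Reasoning
    Nu = neighbours G u
    Nv = neighbours G v

  -- Greedy S r: the tail of an α-sequence whose r remaining vertices are chosen inside S.
  data Greedy (S : Subset n) : ℕ → Set where
    last : ∀ {v} → v ∈ S → IsDeltaSet G S → Greedy S 1
    step : ∀ {v r} → v ∈ S → (∀ u → u ∈ S → inducedDegree G S u ≤ inducedDegree G S v) →
           Greedy (S ∩ neighbours G v) r → Greedy S (suc r)

  -- Weight bound, clique and partition from a greedy choice.

  greedy-weight : ∀ {S r} → Greedy S r → W G S ℚ.≤ ι r
  greedy-weight (last _ δ) = deltaSet-weight≤1 δ
  greedy-weight {S} {suc r} (step {v} _ max g) = begin
    W G S                                                    ≡⟨ W-split S (neighbours G v) ⟩
    W G (S ─ neighbours G v) ℚ.+ W G (S ∩ neighbours G v)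
      ≤⟨ ℚ.+-mono-≤ (deltaSet-weight≤1 (nonneighbours-deltaSet max)) (greedy-weight g) ⟩
    1ℚ ℚ.+ ι r  ≡⟨ ι-suc r ⟨
    ι (suc r)   ∎
    where open ℚ.≤-Reasoning

  -- The inclusion `V ⊆ S` drives the induction: a clique inside `S ∩ neighbours G v` is adjacent to
  -- `v` throughout and cannot contain `v`, so adding `v` enlarges it by one.
  greedy-clique : ∀ {S r} → Greedy S r → ∃ λ V → V ⊆ S × ∣ V ∣ ≡ r × IsClique G V
  greedy-clique {S} (last {v} v∈S _) =
    ⁅ v ⁆ , (λ x∈ → subst (_∈ S) (sym (x∈⁅y⁆⇒x≡y v x∈)) v∈S) , ∣⁅x⁆∣≡1 v ,
    λ x x∈ y y∈ x≢y → contradiction (trans (x∈⁅y⁆⇒x≡y v x∈) (sym (x∈⁅y⁆⇒x≡y v y∈))) x≢y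
  greedy-clique {S} (step {v} v∈S _ g) with greedy-clique g
  ... | V , V⊆ , ∣V∣≡r , clique =
    ⁅ v ⁆ ∪ V , sub , trans (x∉p⇒∣⁅x⁆∪p∣≡1+∣p∣ V (v∉neighbours G v ∘ inN)) (cong suc ∣V∣≡r) , clique′
    where
    inN : ∀ {x} → x ∈ V → x ∈ neighbours G v
    inN = proj₂ ∘ x∈p∩q⁻ S _ ∘ V⊆

    sub : ⁅ v ⁆ ∪ V ⊆ S
    sub x∈ with x∈p∪q⁻ ⁅ v ⁆ V x∈
    ... | inj₁ x∈v = subst (_∈ S) (sym (x∈⁅y⁆⇒x≡y v x∈v)) v∈S
    ... | inj₂ x∈V = proj₁ (x∈p∩q⁻ S _ (V⊆ x∈V))

    clique′ : IsClique G (⁅ v ⁆ ∪ V)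
    clique′ x x∈ y y∈ x≢y with x∈p∪q⁻ ⁅ v ⁆ V x∈ | x∈p∪q⁻ ⁅ v ⁆ V y∈
    ... | inj₂ x∈V | inj₂ y∈V = clique x x∈V y y∈V x≢y
    ... | inj₁ x∈v | inj₂ y∈V rewrite x∈⁅y⁆⇒x≡y v x∈v = ∈neighbours⇒~ (inN y∈V)
    ... | inj₂ x∈V | inj₁ y∈v rewrite x∈⁅y⁆⇒x≡y v y∈v = ~-sym (∈neighbours⇒~ (inN x∈V))
    ... | inj₁ x∈v | inj₁ y∈v =
      contradiction (trans (x∈⁅y⁆⇒x≡y v x∈v) (sym (x∈⁅y⁆⇒x≡y v y∈v))) x≢y

  -- Confining all parts to `S` is what yields disjointness: the later parts lie in
  -- `neighbours G v`, which the new part `S ─ neighbours G v` avoids.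
  greedy-partition : ∀ {S r} → Greedy S r → ∃ λ (parts : Vec (Subset n) r) →
    (∀ v → v ∈ S → ∃ λ i → v ∈ lookup parts i) ×
    (∀ i → lookup parts i ⊆ S) ×
    (∀ i j → i ≢ j → Empty (lookup parts i ∩ lookup parts j)) ×
    (∀ i → IsDeltaSet G (lookup parts i))
  greedy-partition {S} (last _ δ) =
    S ∷ [] , (λ v v∈ → zero , v∈) , (λ { zero x∈ → x∈ }) ,
    (λ { zero zero i≢j → contradiction refl i≢j }) , λ { zero → δ }
  greedy-partition {S} (step {v} _ max g) with greedy-partition g
  ... | parts , covers , within , disjoint , deltaSet =
    (S ─ N) ∷ parts , covers′ , within′ , disjoint′ ,
    λ { zero → nonneighbours-deltaSet max ; (suc i) → deltaSet i }
    where
    N = neighbours G v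

    covers′ : ∀ x → x ∈ S → ∃ λ i → x ∈ lookup ((S ─ N) ∷ parts) i
    covers′ x x∈S with x ∈? N
    ... | no x∉N  = zero , x∈p∧x∉q⇒x∈p─q x∈S x∉N
    ... | yes x∈N with covers x (x∈p∩q⁺ (x∈S , x∈N))
    ...   | i , x∈i = suc i , x∈i

    within′ : ∀ i → lookup ((S ─ N) ∷ parts) i ⊆ S
    within′ zero    = p─q⊆p S N
    within′ (suc i) = proj₁ ∘ x∈p∩q⁻ S N ∘ within i

    apart : ∀ i {x} → x ∈ S ─ N → x ∉ lookup parts i
    apart i x∈ x∈i = x∈p─q⇒x∉q S N x∈ (proj₂ (x∈p∩q⁻ S N (within i x∈i)))

    disjoint′ : ∀ i j → i ≢ j → Empty (lookup ((S ─ N) ∷ parts) i ∩ lookup ((S ─ N) ∷ parts) j)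
    disjoint′ zero    zero    i≢j _        = i≢j refl
    disjoint′ zero    (suc j) _   (x , x∈) with x∈p∩q⁻ (S ─ N) (lookup parts j) x∈
    ... | x∈₀ , x∈j = apart j x∈₀ x∈j
    disjoint′ (suc i) zero    _   (x , x∈) with x∈p∩q⁻ (lookup parts i) (S ─ N) x∈
    ... | x∈i , x∈₀ = apart i x∈₀ x∈i
    disjoint′ (suc i) (suc j) i≢j = disjoint i j (i≢j ∘ cong suc)

  -- From α-sequences to greedy choices.

  before-suc : ∀ (vs : Vec (Fin n) r) i →
    before G vs (suc (toℕ i)) ≡ before G vs (toℕ i) ∩ neighbours G (lookup vs i)
  before-suc (v ∷ vs) zero    = ∩-comm (neighbours G v) ⊤
  -- `⋂` nests to the right, starting from `v`; reassociating brings the newest neighbourhood to the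
  -- outside, the shape that `step` expects.
  before-suc (v ∷ vs) (suc i) = trans (cong (neighbours G v ∩_) (before-suc vs i))
    (sym (∩-assoc (neighbours G v) (before G vs (toℕ i)) (neighbours G (lookup vs i))))

  module _ (vs : Vec (Fin n) r) (α : IsAlphaSequence G vs) where
    open IsAlphaSequence α

    ∈before : ∀ i → lookup vs i ∈ before G vs (toℕ i)
    ∈before i with toℕ i | member i
    ... | zero  | _  = ∈⊤
    ... | suc _ | m  = m (s≤s z≤n)

    -- Merges both α-sequence conditions: at position 0 the set is `⊤`, where induced degree is
    -- degree.
    maxInduced : ∀ i u → u ∈ before G vs (toℕ i) →
      inducedDegree G (before G vs (toℕ i)) u ≤ inducedDegree G (before G vs (toℕ i)) (lookup vs i)
    maxInduced i u u∈ with toℕ i | first i | maxdeg i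
    ... | suc _ | _  | max = max (s≤s z≤n) u u∈
    ... | zero  | max | _
      rewrite ∩-identityʳ (neighbours G u) | ∩-identityʳ (neighbours G (lookup vs i)) = max refl u

  alpha⇒greedy : ∀ {m} (vs : Vec (Fin n) (suc m)) → IsAlphaSequence G vs →
    IsDeltaSet G (before G vs m) → Greedy ⊤ (suc m)
  alpha⇒greedy {m} vs α δ = from m 0 (ℕ.+-identityʳ m)
    where
    -- `k` counts the steps left before the last vertex, so the recursion decreases while the
    -- position `i` rises from 0 to `m`.
    from : ∀ k i → k + i ≡ m → Greedy (before G vs i) (suc k)
    from zero i refl = last (subst (λ i → lookup vs (fromℕ m) ∈ before G vs i) (Fin.toℕ-fromℕ m)
      (∈before vs α (fromℕ m))) δ
    from (suc k) i k+i≡m = subst (λ i → Greedy (before G vs i) (suc (suc k))) j≡i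
      (step (∈before vs α j) (maxInduced vs α j) (subst (λ S → Greedy S (suc k)) (before-suc vs j)
        (from k (suc (toℕ j)) (trans (ℕ.+-suc k (toℕ j)) (trans (cong (λ i → suc (k + i)) j≡i) k+i≡m)))))
      where
      i<1+m : i < suc m
      i<1+m = s≤s (subst (i ≤_) k+i≡m (ℕ.m≤n+m i (suc k)))

      -- The position `i` as an index into `vs`; the facts about `vs` concern `toℕ j` and are
      -- transported along `j≡i`.
      j = fromℕ< i<1+m

      j≡i : toℕ j ≡ i
      j≡i = Fin.toℕ-fromℕ< i<1+m

theorem1 : ∀ {n r : ℕ} (G : Graph n) (vs : Vec (Fin n) r) →
    2 ≤ r →
    IsAlphaSequence G vs →
    IsDeltaSet G (before G vs (r ∸ 1)) →
    (φ G ≤ r × r ≤ ω G) × (+ r) ℚ./ 1 ℚ.≥ W G ⊤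
-- `2 ≤ r` rules out r = 0, and with r = `suc m` the index `r ∸ 1` computes to `m`.
theorem1 {r = suc m} G vs _ α δ = (φ≤r , r≤ω) , greedy-weight G greedy
  where
  greedy : Greedy G ⊤ (suc m)
  greedy = alpha⇒greedy G vs α δ

  φ≤r : φ G ≤ suc m
  φ≤r with greedy-partition G greedy
  ... | parts , covers , _ , disjoint , deltaSet =
    proj₂ (proj₂ (φ-exists G)) (suc m) (parts , mkPartition (λ v → covers v ∈⊤) disjoint deltaSet)

  r≤ω : suc m ≤ ω G
  r≤ω with greedy-clique G greedy
  ... | V , _ , ∣V∣≡r , clique = proj₂ (proj₂ (ω-exists G)) (suc m) (V , ∣V∣≡r , clique)
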